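{- Let $A$ be a free $G$-set with at least two elements, where $G$ is a group, and suppose that $G$ and $A$ are small sets. Then the $\mathfrak{Small}$-ary double centralizer clone $(\Sigma^A)^{\perp\perp(\mathfrak{Small})}$ of $A$ is equal to the clone of $\mathfrak{Small}$-ary derived operations $\langle \Sigma^A\rangle$ of $A$, where $\Sigma$ is the signature consisting of a unary operation symbol $\gamma$ for each $\gamma\in G$.
   Context: Fix a Grothendieck universe $\mathfrak{Small}$, i.e. the set of all sets of rank less than a fixed inaccessible cardinal; its elements are called small sets. A free $G$-set is a set $A$ with an associative and unital left action $G\times A\to A$, $(\gamma,a)\mapsto\gamma a$, such that for all $\gamma\in G$ and $a\in A$, if $\gamma a=a$ then $\gamma=1$. $\Sigma^A$ denotes the set of basic unary operations $a\mapsto\gamma a$ on $A$ $(\gamma\in G)$. A $\mathfrak{Small}$-ary operation on a set $A$ is a map $A^X \to A$ with $X$ a small set (its arity); nullary operations are allowed. A $\mathfrak{Small}$-ary clone on $A$ is a set $F$ of $\mathfrak{Small}$-ary operations on $A$ that contains all projections $\pi_x:A^X\to A$ ($X$ small, $x\in X$) and is such that for all small $X,Y$, every $f:A^Y\to A$ in $F$ and every family $g_y:A^X\to A$ $(y\in Y)$ in $F$, the composite $f\circ(g_y)_{y\in Y}:A^X\to A$ lies in $F$. The clone of $\mathfrak{Small}$-ary derived operations $\langle\Sigma^A\rangle$ is the smallest $\mathfrak{Small}$-ary clone on $A$ containing $\Sigma^A$. Operations $f:A^X\to A$ and $g:A^Y\to A$ commute, written $f\perp g$, if for every matrix $a=(a_{xy})\in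 A^{X\times Y}$ one has $g\bigl((f((a_{xy})_{x\in X}))_{y\in Y}\bigr)=f\bigl((g((a_{xy})_{y\in Y}))_{x\in X}\bigr)$. For a set $F$ of $\mathfrak{Small}$-ary operations on $A$, $F^{\perp(\mathfrak{Small})}$ is the set of all $\mathfrak{Small}$-ary operations $f$ on $A$ with $f\perp g$ for all $g\in F$, and $F^{\perp\perp(\mathfrak{Small})}$ is the result of applying $(-)^{\perp(\mathfrak{Small})}$ twice to $F$. -}

module Defs where

open import Algebra.Bundles using (Group)
open import Data.Product using (_,_)
open import Data.Product.Relation.Binary.Pointwise.NonDependent using (_×ₛ_)
open import Data.Unit.Polymorphic using (tt)
import Data.Unit.Polymorphic.Properties as Unit
open import Function.Bundles using (Func; _⟨$⟩_)
import Function.Construct.Composition as Compose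
import Function.Relation.Binary.Setoid.Equality as FuncEq
open import Level using (Level; suc; _⊔_)
open import Relation.Binary.Bundles using (Setoid)
open import Relation.Unary using (Pred; _⊆_)

-- Sets are rendered as setoids, as for the library's `Group`, and maps as
-- equality-preserving functions.  The universe of small sets is `Setoid ℓ ℓ`
-- for an arbitrary level ℓ.

Small : (ℓ : Level) → Set (suc ℓ)
Small ℓ = Setoid ℓ ℓ

module _ {ℓ : Level} where

  open FuncEq public using () renaming (_⇨_ to Maps)

  record GSet (G : Group ℓ ℓ) : Set (suc ℓ) where
    private module G = Group G
    infixr 7 _·_
    field
      setoid : Small ℓ
    open Setoid setoid public using (Carrier; _≈_)
    field
      _·_        : G.Carrier → Carrier → Carrier
      ·-cong     : ∀ {γ δ a b} → γ G.≈ δ → a ≈ b → γ · a ≈ δ · b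
      ·-assoc    : ∀ γ δ a → (γ G.∙ δ) · a ≈ γ · (δ · a)
      ·-identity : ∀ a → G.ε · a ≈ a

  IsFree : {G : Group ℓ ℓ} → GSet G → Set ℓ
  IsFree {G} A = ∀ γ a → γ · a ≈ a → γ G.≈ G.ε
    where
      module G = Group G
      open GSet A

  module Operations (A : Small ℓ) where

    open Setoid A using (_≈_)

    infixr 8 A^_
    A^_ : Small ℓ → Small ℓ
    A^ X = Maps X A

    OperationSetoid : Small ℓ → Small ℓ
    OperationSetoid X = Maps (A^ X) A

    Operation : Small ℓ → Set ℓ
    Operation X = Setoid.Carrier (OperationSetoid X)

    infix 4 _≈ₒ_
    _≈ₒ_ : {X : Small ℓ} → Operation X → Operation X → Set ℓ
    _≈ₒ_ {X} = Setoid._≈_ (OperationSetoid X)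

    -- A set of small-ary operations.
    OperationSet : (p : Level) → Set (suc (ℓ ⊔ p))
    OperationSet p = (X : Small ℓ) → Pred (Operation X) p

    projection : {X : Small ℓ} → Setoid.Carrier X → Operation X
    projection x = record { to = λ a → a ⟨$⟩ x ; cong = λ a≈b → a≈b x }

    -- The map a ↦ (g_y(a))_y associated with a family of operations g.
    tuple : {X Y : Small ℓ} → Func Y (OperationSetoid X) → Func (A^ X) (A^ Y)
    tuple g = record
      { to   = λ a → record
          { to   = λ y → (g ⟨$⟩ y) ⟨$⟩ a
          ; cong = λ y≈y′ → Func.cong g y≈y′ a
          }
      ; cong = λ a≈b y → Func.cong (g ⟨$⟩ y) a≈b
      }

    composite : {X Y : Small ℓ} →
                Operation Y → Func Y (OperationSetoid X) → Operation X
    composite f g = Compose.function (tuple g) f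

    -- Since equality is a setoid equality, being a set of operations
    -- includes closure under equality.
    record IsClone {p : Level} (F : OperationSet p) : Set (suc ℓ ⊔ p) where
      field
        respects    : ∀ {X} {f g : Operation X} → f ≈ₒ g → F X f → F X g
        projections : ∀ {X} (x : Setoid.Carrier X) → F X (projection x)
        composites  : ∀ {X Y} (f : Operation Y)
                      (g : Func Y (OperationSetoid X)) →
                      F Y f → (∀ y → F X (g ⟨$⟩ y)) → F X (composite f g)

    data ⟨_⟩ {p : Level} (F : OperationSet p) : OperationSet (suc ℓ ⊔ p) where
      generator   : ∀ {X} {f : Operation X} → F X f → ⟨ F ⟩ X f
      respects    : ∀ {X} {f g : Operation X} →
                    f ≈ₒ g → ⟨ F ⟩ X f → ⟨ F ⟩ X g
      projections : ∀ {X} (x : Setoid.Carrier X) → ⟨ F ⟩ X (projection x)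
      composites  : ∀ {X Y} (f : Operation Y)
                    (g : Func Y (OperationSetoid X)) →
                    ⟨ F ⟩ Y f → (∀ y → ⟨ F ⟩ X (g ⟨$⟩ y)) →
                    ⟨ F ⟩ X (composite f g)

    -- ⟨ F ⟩ is the smallest clone containing F (which it does by `generator`).

    ⟨⟩-isClone : ∀ {p} (F : OperationSet p) → IsClone ⟨ F ⟩
    ⟨⟩-isClone F = record
      { respects = respects ; projections = projections ; composites = composites }

    ⟨⟩-smallest : ∀ {p q} (F : OperationSet p) (H : OperationSet q) →
                  IsClone H → (∀ X → F X ⊆ H X) → ∀ X → ⟨ F ⟩ X ⊆ H X
    ⟨⟩-smallest F H clone F⊆H = go
      where
        module H = IsClone clone
        go : ∀ X → ⟨ F ⟩ X ⊆ H X
        go X (generator f∈F)         = F⊆H X f∈F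
        go X (respects f≈g f∈)       = H.respects f≈g (go X f∈)
        go X (projections x)         = H.projections x
        go X (composites {Y = Y} f g f∈ g∈) =
          H.composites f g (go Y f∈) (λ y → go X (g∈ y))

    Matrix : Small ℓ → Small ℓ → Set ℓ
    Matrix X Y = Func (X ×ₛ Y) A

    -- columns a = ((a_{xy})_{x∈X})_{y∈Y} and rows a = ((a_{xy})_{y∈Y})_{x∈X}.

    columns : {X Y : Small ℓ} → Matrix X Y → Func Y (A^ X)
    columns {X} {Y} a = record
      { to   = λ y → record
          { to   = λ x → a ⟨$⟩ (x , y)
          ; cong = λ x≈x′ → Func.cong a (x≈x′ , Setoid.refl Y)
          }
      ; cong = λ y≈y′ x → Func.cong a (Setoid.refl X , y≈y′)
      }

    rows : {X Y : Small ℓ} → Matrix X Y → Func X (A^ Y)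
    rows {X} {Y} a = record
      { to   = λ x → record
          { to   = λ y → a ⟨$⟩ (x , y)
          ; cong = λ y≈y′ → Func.cong a (Setoid.refl X , y≈y′)
          }
      ; cong = λ x≈x′ y → Func.cong a (x≈x′ , Setoid.refl Y)
      }

    infix 4 _⊥_
    _⊥_ : {X Y : Small ℓ} → Operation X → Operation Y → Set ℓ
    _⊥_ {X} {Y} f g = (a : Matrix X Y) →
      g ⟨$⟩ Compose.function (columns a) f ≈ f ⟨$⟩ Compose.function (rows a) g

    infix 9 _^⊥ _^⊥⊥
    _^⊥ : {p : Level} → OperationSet p → OperationSet (suc ℓ ⊔ p)
    (F ^⊥) X f = ∀ (Y : Small ℓ) (g : Operation Y) → F Y g → f ⊥ g

    _^⊥⊥ : {p : Level} → OperationSet p → OperationSet (suc ℓ ⊔ p)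
    F ^⊥⊥ = (F ^⊥) ^⊥

  module _ {G : Group ℓ ℓ} (A : GSet G) where

    open GSet A
    open Operations setoid
    private module G = Group G

    𝟙 : Small ℓ
    𝟙 = Unit.≡-setoid ℓ

    basicOperation : G.Carrier → Operation 𝟙
    basicOperation γ = record
      { to   = λ a → γ · (a ⟨$⟩ tt)
      ; cong = λ a≈b → ·-cong G.refl (a≈b tt)
      }

    data BasicOperations : OperationSet ℓ where
      basic : (γ : G.Carrier) {f : Operation 𝟙} →
              basicOperation γ ≈ₒ f → BasicOperations 𝟙 f

{-# OPTIONS --safe #-}

-- Let g : A^X → A be in the double centralizer and put Y = A^X.  Commutation
-- of g with an equivariant f : A^Y → A, applied to the evaluation matrix
-- (y(x)), reads f(g) = g((f(π_x))_x): the value of f at the point g of A^Y is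
-- determined by its values at the projections π_x.  Since Y is nonempty, A^Y
-- is a free G-set, so an equivariant f can be altered on the orbit of g
-- alone, giving g any prescribed new value.  As A has two elements, this is a
-- contradiction unless that orbit contains some π_x, i.e. g = γ π_x.
module Submission where

open import Defs
open import Algebra.Bundles using (Group)
import Algebra.Properties.Group as GroupProperties
open import Axiom.ExcludedMiddle using (ExcludedMiddle)
open import Data.Empty using (⊥-elim)
open import Data.Product using (∃₂; ∃; _,_; swap)
open import Data.Unit.Polymorphic using (tt)
open import Function.Base using (_∘_)
open import Function.Bundles using (Func; _⟨$⟩_)
import Function.Construct.Composition as Compose
import Function.Construct.Constant as Constant
open import Level using (Level)
open import Relation.Binary.Bundles using (Setoid)
import Relation.Binary.Reasoning.Setoid as SetoidReasoning
open import Relation.Nullary using (¬_; Dec; yes; no)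
open import Relation.Nullary.Decidable using (decidable-stable)
open import Relation.Unary using (_⊆_; _≐_)

private variable
  ℓ p : Level

module Centralizers (A : Small ℓ) where

  open Setoid A using (_≈_; sym; trans) renaming (refl to ≈-refl)
  open Operations A
  open SetoidReasoning A

  -- Transposing the matrix exchanges its rows and columns.
  ⊥-sym : {X Y : Small ℓ} {f : Operation X} {g : Operation Y} → f ⊥ g → g ⊥ f
  ⊥-sym {X} {Y} {f} {g} f⊥g a = begin
    f ⟨$⟩ Compose.function (columns a) g  ≈⟨ Func.cong f (λ _ → Func.cong g (λ _ → ≈-refl)) ⟩
    f ⟨$⟩ Compose.function (rows aᵀ) g    ≈⟨ f⊥g aᵀ ⟨
    g ⟨$⟩ Compose.function (columns aᵀ) f ≈⟨ Func.cong g (λ _ → Func.cong f (λ _ → ≈-refl)) ⟩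
    g ⟨$⟩ Compose.function (rows a) f     ∎
    where
    aᵀ : Matrix X Y
    aᵀ = record { to = λ xy → a ⟨$⟩ swap xy ; cong = Func.cong a ∘ swap }

  ⊆-^⊥⊥ : (F : OperationSet p) (X : Small ℓ) → F X ⊆ (F ^⊥⊥) X
  ⊆-^⊥⊥ F X {f} f∈F Y g g∈F^⊥ = ⊥-sym {f = g} {g = f} (g∈F^⊥ X f f∈F)

  -- The operation `h` is moved past `f` on the matrix `b` of values of the `g_y` on the columns of
  -- `a`, and then past each `g_y` separately.
  composite-⊥ : {X Y Z : Small ℓ} (f : Operation Y)
                (g : Func Y (OperationSetoid X)) (h : Operation Z) →
                f ⊥ h → (∀ y → (g ⟨$⟩ y) ⊥ h) → composite f g ⊥ h
  composite-⊥ {X} {Y} {Z} f g h f⊥h g⊥h a = begin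
    h ⟨$⟩ Compose.function (columns a) (composite f g)
      ≈⟨ Func.cong h (λ _ → Func.cong f (λ _ → ≈-refl)) ⟩
    h ⟨$⟩ Compose.function (columns b) f
      ≈⟨ f⊥h b ⟩
    f ⟨$⟩ Compose.function (rows b) h
      ≈⟨ Func.cong f (λ y → trans (Func.cong h (λ _ → ≈-refl)) (g⊥h y a)) ⟩
    composite f g ⟨$⟩ Compose.function (rows a) h ∎
    where
    b : Matrix Y Z
    b = record
      { to   = λ (y , z) → (g ⟨$⟩ y) ⟨$⟩ (columns a ⟨$⟩ z)
      ; cong = λ {(y , _)} (y≈y′ , z≈z′) →
          trans (Func.cong (g ⟨$⟩ y) (Func.cong (columns a) z≈z′))
                (Func.cong g y≈y′ _)
      }

  ^⊥-isClone : (F : OperationSet p) → IsClone (F ^⊥)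
  ^⊥-isClone F = record
    { respects    = λ f≈g f∈ Y h h∈F a →
        trans (Func.cong h (λ _ → sym (f≈g _))) (trans (f∈ Y h h∈F a) (f≈g _))
    ; projections = λ x Y h h∈F a → Func.cong h (λ _ → ≈-refl)
    ; composites  = λ f g f∈ g∈ Y h h∈F →
        composite-⊥ f g h (f∈ Y h h∈F) (λ y → g∈ y Y h h∈F)
    }

  -- A double centralizer is itself a centralizer, hence a clone, so minimality of `⟨ F ⟩` applies.
  ⟨⟩-⊆-^⊥⊥ : (F : OperationSet p) (X : Small ℓ) → ⟨ F ⟩ X ⊆ (F ^⊥⊥) X
  ⟨⟩-⊆-^⊥⊥ F = ⟨⟩-smallest F (F ^⊥⊥) (^⊥-isClone (F ^⊥)) (⊆-^⊥⊥ F)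

  -- Its column at `y` is `y` itself and its row at `x` is the projection at `x`. Hence `g` applied
  -- to all columns gives back `g`, seen as a point of `A^ (A^ X)`.
  evaluation : (X : Small ℓ) → Matrix X (A^ X)
  evaluation X = record
    { to   = λ (x , y) → y ⟨$⟩ x
    ; cong = λ {(_ , y)} (x≈x′ , y≈y′) → trans (Func.cong y x≈x′) (y≈y′ _)
    }

  projectionFamily : (X : Small ℓ) → Func X (OperationSetoid X)
  projectionFamily X = record { to = projection ; cong = λ x≈x′ a → Func.cong a x≈x′ }

  ⊥-evaluation : {X : Small ℓ} (g : Operation X) (f : Operation (A^ X)) → g ⊥ f →
                 f ⟨$⟩ g ≈ g ⟨$⟩ Compose.function (projectionFamily X) f
  ⊥-evaluation {X} g f g⊥f = begin
    f ⟨$⟩ g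
      ≈⟨ Func.cong f (λ _ → Func.cong g (λ _ → ≈-refl)) ⟩
    f ⟨$⟩ Compose.function (columns (evaluation X)) g
      ≈⟨ g⊥f (evaluation X) ⟩
    g ⟨$⟩ Compose.function (rows (evaluation X)) f
      ≈⟨ Func.cong g (λ _ → Func.cong f (λ _ → ≈-refl)) ⟩
    g ⟨$⟩ Compose.function (projectionFamily X) f ∎

module _ {G : Group ℓ ℓ} (A : GSet G) where

  private module G = Group G
  open GSet A
  open Setoid setoid using (sym; trans) renaming (refl to ≈-refl)
  open Operations setoid
  open Centralizers setoid
  open SetoidReasoning setoid

  translate : {X : Small ℓ} → G.Carrier → Func X setoid → Func X setoid
  translate γ a = record
    { to   = λ x → γ · (a ⟨$⟩ x)
    ; cong = λ x≈x′ → ·-cong G.refl (Func.cong a x≈x′)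
    }

  Equivariant : {X : Small ℓ} → Operation X → Set ℓ
  Equivariant {X} f = ∀ γ (a : Func X setoid) → f ⟨$⟩ translate γ a ≈ γ · (f ⟨$⟩ a)

  -- A basic operation has arity `𝟙`, so the matrix is a single column and commutation reduces to
  -- equivariance.
  equivariant⇒^⊥ : {X : Small ℓ} (f : Operation X) → Equivariant f →
                   (BasicOperations A ^⊥) X f
  equivariant⇒^⊥ f f-equivariant Y h (basic γ γ≈h) a = begin
    h ⟨$⟩ Compose.function (columns a) f             ≈⟨ γ≈h _ ⟨
    γ · (f ⟨$⟩ (columns a ⟨$⟩ tt))                   ≈⟨ f-equivariant γ _ ⟨
    f ⟨$⟩ translate γ (columns a ⟨$⟩ tt)             ≈⟨ Func.cong f (λ _ → γ≈h _) ⟩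
    f ⟨$⟩ Compose.function (rows a) h                ∎

  translatedProjection∈⟨⟩ : {X : Small ℓ} (γ : G.Carrier) (x : Setoid.Carrier X) →
    ⟨ BasicOperations A ⟩ X (translate γ (projection x))
  translatedProjection∈⟨⟩ {X} γ x = respects (λ _ → ≈-refl)
    (composites (basicOperation A γ) (Constant.function (𝟙 A) (OperationSetoid X) (projection x))
      (generator (basic γ (λ _ → ≈-refl))) (λ _ → projections x))

  ·-inverseˡ : ∀ γ a → γ G.⁻¹ · (γ · a) ≈ a
  ·-inverseˡ γ a = begin
    γ G.⁻¹ · (γ · a)   ≈⟨ ·-assoc _ _ _ ⟨
    (γ G.⁻¹ G.∙ γ) · a ≈⟨ ·-cong (G.inverseˡ γ) ≈-refl ⟩
    G.ε · a            ≈⟨ ·-identity a ⟩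
    a                  ∎

  -- Freeness is applied to `δ⁻¹γ`, which fixes `a`.
  ·-cancelʳ : IsFree A → ∀ {γ δ a} → γ · a ≈ δ · a → γ G.≈ δ
  ·-cancelʳ free {γ} {δ} {a} γa≈δa = G.sym (inverse-unique (free _ a (begin
    (δ G.⁻¹ G.∙ γ) · a ≈⟨ ·-assoc _ _ _ ⟩
    δ G.⁻¹ · (γ · a)   ≈⟨ ·-cong G.refl γa≈δa ⟩
    δ G.⁻¹ · (δ · a)   ≈⟨ ·-inverseˡ δ a ⟩
    a                  ∎)))
    where
    open GroupProperties G
    inverse-unique : δ G.⁻¹ G.∙ γ G.≈ G.ε → δ G.≈ γ
    inverse-unique δ⁻¹γ≈ε =
      G.trans (G.sym (⁻¹-involutive δ)) (G.sym (inverseʳ-unique _ _ δ⁻¹γ≈ε))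

  module Alteration (em : ExcludedMiddle ℓ) (free : IsFree A)
    {Y : Small ℓ} (y₀ : Setoid.Carrier Y) (p : Func Y setoid) (c : Carrier) where

    open Setoid (A^ Y) using () renaming (_≈_ to _≈₁_)

    InOrbit : Func Y setoid → Set ℓ
    InOrbit q = ∃ λ δ → q ≈₁ translate δ p

    -- The equivariant map being altered is evaluation at `y₀`. The decision is an explicit argument
    -- so that proofs can match on it; the `δ` inside it is an arbitrary witness.
    value : (q : Func Y setoid) → Dec (InOrbit q) → Carrier
    value q (yes (δ , _)) = δ · c
    value q (no _)        = q ⟨$⟩ y₀

    -- With `r` only equal to the translate of `q`, and separate decisions for the two, the case
    -- `γ = ε` also yields the congruence of `altered`.
    value-equivariant : ∀ γ {q r} → r ≈₁ translate γ q →
                        (dq : Dec (InOrbit q)) (dr : Dec (InOrbit r)) →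
                        value r dr ≈ γ · value q dq
    -- Comparing coordinates at `y₀`, freeness forces `η = γδ`.
    value-equivariant γ r≈γq (yes (δ , q≈δp)) (yes (η , r≈ηp)) = trans
      (·-cong (·-cancelʳ free (begin
        η · (p ⟨$⟩ y₀)          ≈⟨ r≈ηp y₀ ⟨
        _                       ≈⟨ r≈γq y₀ ⟩
        _                       ≈⟨ ·-cong G.refl (q≈δp y₀) ⟩
        γ · (δ · (p ⟨$⟩ y₀))    ≈⟨ ·-assoc _ _ _ ⟨
        (γ G.∙ δ) · (p ⟨$⟩ y₀)  ∎)) ≈-refl)
      (·-assoc _ _ _)
    -- The mixed cases are void, since an orbit is stable under `γ` and `γ⁻¹`.
    value-equivariant γ r≈γq (yes (δ , q≈δp)) (no ∉) = ⊥-elim (∉ (γ G.∙ δ , λ y →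
      trans (r≈γq y) (trans (·-cong G.refl (q≈δp y)) (sym (·-assoc _ _ _)))))
    value-equivariant γ r≈γq (no ∉) (yes (η , r≈ηp)) = ⊥-elim (∉ (γ G.⁻¹ G.∙ η , λ y →
      trans (sym (·-inverseˡ γ _))
        (trans (·-cong G.refl (trans (sym (r≈γq y)) (r≈ηp y))) (sym (·-assoc _ _ _)))))
    value-equivariant γ r≈γq (no _) (no _) = r≈γq y₀

    altered : Operation Y
    altered = record
      { to   = λ q → value q em
      ; cong = λ {q} {r} q≈r → sym (trans
          (value-equivariant G.ε (λ y → trans (sym (q≈r y)) (sym (·-identity _))) em em)
          (·-identity _))
      }

    altered-equivariant : Equivariant altered
    altered-equivariant γ q = value-equivariant γ (λ _ → ≈-refl) em em

    altered-at : altered ⟨$⟩ p ≈ c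
    altered-at = at em
      where
      at : (d : Dec (InOrbit p)) → value p d ≈ c
      -- Whatever witness `em` supplies, it fixes `p` and so equals `ε` by freeness.
      at (yes (δ , p≈δp)) =
        trans (·-cong (free δ _ (sym (p≈δp y₀))) ≈-refl) (·-identity c)
      at (no ∉) = ⊥-elim (∉ (G.ε , λ _ → sym (·-identity _)))

    altered-off : ∀ q → ¬ InOrbit q → altered ⟨$⟩ q ≈ q ⟨$⟩ y₀
    altered-off q q∉ = off em
      where
      off : (d : Dec (InOrbit q)) → value q d ≈ q ⟨$⟩ y₀
      off (yes q∈) = ⊥-elim (q∉ q∈)
      off (no _)   = ≈-refl

  TranslatedProjection : {X : Small ℓ} → Operation X → Set ℓ
  TranslatedProjection {X} g = ∃₂ λ γ (x : Setoid.Carrier X) → translate γ (projection x) ≈ₒ g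

  module _ (em : ExcludedMiddle ℓ) (free : IsFree A) where

    -- The alteration sends g to c, but is evaluation at y₀ on every π_x since
    -- none of them lies in the orbit of g.
    value-arbitrary : {X : Small ℓ} (g : Operation X) → (BasicOperations A ^⊥⊥) X g →
      ¬ TranslatedProjection g → (y₀ : Func X setoid) (c : Carrier) → c ≈ g ⟨$⟩ y₀
    value-arbitrary {X} g g∈ g∉ y₀ c = begin
      c                                                   ≈⟨ altered-at ⟨
      altered ⟨$⟩ g                                       ≈⟨ ⊥-evaluation g altered
        (g∈ _ altered (equivariant⇒^⊥ altered altered-equivariant)) ⟩
      g ⟨$⟩ Compose.function (projectionFamily X) altered ≈⟨ Func.cong g
        (λ x → altered-off (projection x) (λ (δ , πₓ≈δg) → g∉ (δ G.⁻¹ , x , λ a →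
          trans (·-cong G.refl (πₓ≈δg a)) (·-inverseˡ δ _)))) ⟩
      g ⟨$⟩ y₀                                            ∎
      where open Alteration em free y₀ g c

    -- Otherwise `a` and `b` would both equal the value of `g` at `y₀`.
    ^⊥⊥⇒translatedProjection : (∃₂ λ a b → ¬ a ≈ b) → {X : Small ℓ} (g : Operation X) →
      (BasicOperations A ^⊥⊥) X g → TranslatedProjection g
    ^⊥⊥⇒translatedProjection (a , b , a≉b) {X} g g∈ = decidable-stable em λ g∉ →
      a≉b (trans (value-arbitrary g g∈ g∉ y₀ a) (sym (value-arbitrary g g∈ g∉ y₀ b)))
      where
      y₀ : Func X setoid
      -- Any point of `A^ X` would serve; a constant one exists for every `X`, empty or not.
      y₀ = Constant.function X setoid a

theorem8p1 : ∀ {ℓ} → ExcludedMiddle ℓ →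
    (G : Group ℓ ℓ) (A : GSet G) →
    IsFree A →
    (∃₂ λ (a b : GSet.Carrier A) → ¬ (GSet._≈_ A a b)) →
    let open Operations (GSet.setoid A) in
    (X : Small ℓ) → (BasicOperations A ^⊥⊥) X ≐ ⟨ BasicOperations A ⟩ X
theorem8p1 em G A free a≉b X =
    (λ {g} g∈ → let (γ , x , γπₓ≈g) = ^⊥⊥⇒translatedProjection A em free a≉b g g∈ in
       respects γπₓ≈g (translatedProjection∈⟨⟩ A γ x))
  , Centralizers.⟨⟩-⊆-^⊥⊥ (GSet.setoid A) (BasicOperations A) X
  where open Operations (GSet.setoid A)
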